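{- Let $y,z$ be nonzero complex numbers and let $u_n=u_n(y,z)$, $v_n=v_n(y,z)$ be the Lucas sequences of the first and second kind. Let $x,r\in\mathbb{C}$ and let $c,n$ be integers with $n\ge c$; if $c<0$ assume moreover $x\neq 0$. Then \[ \sum_{k=c}^n r^{n-k}x^k\big(r v_k(y,z)+(xy-2r)u_{k+1}(y,z)\big)=x^{n+1}y\,u_{n+1}(y,z)-r^{n-c+1}x^c y\,u_c(y,z) \] and \[ \sum_{k=c}^n r^{n-k}x^k\big((y^2-4z)r\,u_k(y,z)+(xy-2r)v_{k+1}(y,z)\big)=x^{n+1}y\,v_{n+1}(y,z)-r^{n-c+1}x^c y\,v_c(y,z). \]
   Context: For nonzero complex numbers $y,z$, the Lucas sequences $u_n(y,z)$ and $v_n(y,z)$ are defined by $u_0=0$, $u_1=1$, $v_0=2$, $v_1=y$ and $w_n=y\,w_{n-1}-z\,w_{n-2}$ for $n\ge 2$ (for $w=u$ and $w=v$), and extended to negative indices by $u_{ -n}(y,z)=-u_n(y,z)/z^n$ and $v_{ -n}(y,z)=v_n(y,z)/z^n$. -}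

module Defs where

open import Level using (0ℓ)
open import Algebra.Bundles using (CommutativeRing)
open import Algebra.Apartness.Bundles using (HeytingField; HeytingCommutativeRing)
open import Data.Empty using (⊥-elim)
open import Data.Fin.Base using (toℕ)
open import Data.Integer.Base as ℤ using (ℤ; +_; -[1+_]; 0ℤ; 1ℤ)
import Data.Integer.Properties as ℤ
open import Data.Nat.Base as ℕ using (ℕ; zero; suc)
import Data.Nat.Properties as ℕ
open import Data.Product.Base using (∃; _×_; _,_; proj₁; proj₂)
open import Data.Rational.Base as ℚ using (ℚ; 0ℚ; 1ℚ; ½; ∣_∣; 1/_)
import Data.Rational.Properties as ℚ
open import Data.Rational.Solver using (module +-*-Solver)
open import Data.Sum.Base as Sum using (_⊎_; inj₁; inj₂)
open import Relation.Binary.PropositionalEquality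
  using (_≡_; _≢_; refl; sym; trans; cong; cong₂; subst; subst₂)
open import Relation.Nullary using (¬_; Dec; yes; no)

module RationalEstimates where

  open import Data.Rational.Base using (_+_; _*_; _-_; -_; _≤_; _<_)

  private variable
    a b s t : ℚ

  half : ℚ → ℚ
  half ε = ½ * ε

  half+half : ∀ ε → half ε + half ε ≡ ε
  half+half ε = trans (sym (ℚ.*-distribʳ-+ ε ½ ½)) (ℚ.*-identityˡ ε)

  *-pos : 0ℚ < a → 0ℚ < b → 0ℚ < a * b
  *-pos {a} {b} 0<a 0<b =
    subst (_< a * b) (ℚ.*-zeroʳ a) (ℚ.*-monoʳ-<-pos a {{ℚ.positive 0<a}} 0<b)

  half-pos : 0ℚ < a → 0ℚ < half a
  half-pos = *-pos (ℚ.positive⁻¹ ½)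

  +-pos : 0ℚ ≤ a → 0ℚ < b → 0ℚ < a + b
  +-pos = ℚ.+-mono-≤-<

  *-mono-≤ : 0ℚ ≤ a → a ≤ s → 0ℚ ≤ b → b ≤ t → a * b ≤ s * t
  *-mono-≤ {a} {s} {b} {t} 0≤a a≤s 0≤b b≤t = ℚ.≤-trans
    (ℚ.*-monoʳ-≤-nonNeg b {{ℚ.nonNegative 0≤b}} a≤s)
    (ℚ.*-monoˡ-≤-nonNeg s {{ℚ.nonNegative (ℚ.≤-trans 0≤a a≤s)}} b≤t)

  ∣+∣≤ : ∣ a ∣ ≤ s → ∣ b ∣ ≤ t → ∣ a + b ∣ ≤ s + t
  ∣+∣≤ {a} {b = b} p q = ℚ.≤-trans (ℚ.∣p+q∣≤∣p∣+∣q∣ a b) (ℚ.+-mono-≤ p q)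

  ∣*∣≤ : ∣ a ∣ ≤ s → ∣ b ∣ ≤ t → ∣ a * b ∣ ≤ s * t
  ∣*∣≤ {a} {b = b} p q = ℚ.≤-trans (ℚ.≤-reflexive (ℚ.∣p*q∣≡∣p∣*∣q∣ a b))
    (*-mono-≤ (ℚ.0≤∣p∣ a) p (ℚ.0≤∣p∣ b) q)

  ∣-∣-swap : ∀ a b → ∣ a - b ∣ ≡ ∣ b - a ∣
  ∣-∣-swap a b = trans (cong ∣_∣ (solve 2 (λ a b → a :- b := :- (b :- a)) refl a b))
                       (ℚ.∣-p∣≡∣p∣ (b - a))
    where open +-*-Solver

  ≤-cancelʳ : a + b ≤ s + b → a ≤ s
  ≤-cancelʳ {a} {b} {s} p = subst₂ _≤_ (lem a b) (lem s b) (ℚ.+-monoˡ-≤ (- b) p)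
    where
    open +-*-Solver
    lem : ∀ a b → (a + b) + - b ≡ a
    lem = solve 2 (λ a b → (a :+ b) :+ :- b := a) refl

  recip : ℚ → ℚ
  recip p with p ℚ.≟ 0ℚ
  ... | yes _   = 0ℚ
  ... | no p≢0 = (1/ p) {{ℚ.≢-nonZero p≢0}}

  recip-inverse : ∀ p → p ≢ 0ℚ → p * recip p ≡ 1ℚ
  recip-inverse p p≢0 with p ℚ.≟ 0ℚ
  ... | yes p≡0  = ⊥-elim (p≢0 p≡0)
  ... | no  p≢0′ = ℚ.*-inverseʳ p {{ℚ.≢-nonZero p≢0′}}

  >⇒≢ : 0ℚ < a → a ≢ 0ℚ
  >⇒≢ 0<a a≡0 = ℚ.<⇒≢ 0<a (sym a≡0)

  recip-pos : 0ℚ < a → 0ℚ < recip a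
  recip-pos {a} 0<a = ℚ.*-cancelˡ-<-nonNeg a {{ℚ.nonNegative (ℚ.<⇒≤ 0<a)}}
    (subst₂ _<_ (sym (ℚ.*-zeroʳ a)) (sym (recip-inverse a (>⇒≢ 0<a))) (ℚ.positive⁻¹ 1ℚ))

  ∣∣≥⇒≢0 : 0ℚ < s → s ≤ ∣ a ∣ → a ≢ 0ℚ
  ∣∣≥⇒≢0 0<s s≤ refl = ℚ.<-irrefl refl (ℚ.<-≤-trans 0<s s≤)

  recip-cancel : 0ℚ < b → ∀ a → b * (recip b * a) ≡ a
  recip-cancel {b} 0<b a = trans (sym (ℚ.*-assoc b (recip b) a))
    (trans (cong (_* a) (recip-inverse b (>⇒≢ 0<b))) (ℚ.*-identityˡ a))

  ∣recip∣≤ : 0ℚ < s → s ≤ ∣ a ∣ → ∣ recip a ∣ ≤ recip s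
  ∣recip∣≤ {s} {a} 0<s s≤ = subst₂ _≤_ lhs rhs
    (*-mono-≤ (ℚ.≤-trans (ℚ.<⇒≤ 0<s) ℚ.≤-refl) s≤
      (ℚ.≤-trans (ℚ.≤-reflexive (sym (ℚ.*-zeroˡ 0ℚ)))
        (*-mono-≤ ℚ.≤-refl (ℚ.<⇒≤ (recip-pos 0<s)) ℚ.≤-refl (ℚ.0≤∣p∣ (recip a))))
      ℚ.≤-refl)
    where
    open +-*-Solver
    lhs : s * (recip s * ∣ recip a ∣) ≡ ∣ recip a ∣
    lhs = recip-cancel 0<s ∣ recip a ∣
    swap : ∀ x y z → x * (y * z) ≡ y * (x * z)
    swap = solve 3 (λ x y z → x :* (y :* z) := y :* (x :* z)) refl
    ∣a∣*∣recip∣ : ∣ a ∣ * ∣ recip a ∣ ≡ 1ℚ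
    ∣a∣*∣recip∣ = trans (sym (ℚ.∣p*q∣≡∣p∣*∣q∣ a (recip a)))
      (cong ∣_∣ (recip-inverse a (∣∣≥⇒≢0 0<s s≤)))
    rhs : ∣ a ∣ * (recip s * ∣ recip a ∣) ≡ recip s
    rhs = trans (swap (∣ a ∣) (recip s) (∣ recip a ∣))
      (trans (cong (recip s *_) ∣a∣*∣recip∣) (ℚ.*-identityʳ (recip s)))

  recip-diff : a ≢ 0ℚ → b ≢ 0ℚ → recip a - recip b ≡ (recip a * recip b) * (b - a)
  recip-diff {a} {b} a≢0 b≢0 = sym (trans (lem a b (recip a) (recip b))
    (cong₂ _-_ (cancel (recip a) (recip-inverse b b≢0)) (cancel (recip b) (recip-inverse a a≢0))))
    where
    open +-*-Solver
    lem : ∀ a b p q → (p * q) * (b - a) ≡ p * (b * q) - q * (a * p)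
    lem = solve 4 (λ a b p q → (p :* q) :* (b :- a) := p :* (b :* q) :- q :* (a :* p)) refl
    cancel : ∀ p {q} → q ≡ 1ℚ → p * q ≡ p
    cancel p refl = ℚ.*-identityʳ p

  scale-half : 0ℚ < b → ∀ ε → b * (recip b * half ε) ≡ half ε
  scale-half 0<b ε = recip-cancel 0<b (half ε)

  square-≥0 : ∀ a → 0ℚ ≤ a * a
  square-≥0 a = subst (0ℚ ≤_) (lem (ℚ.∣p∣≡p∨∣p∣≡-p a))
    (subst (_≤ ∣ a ∣ * ∣ a ∣) (ℚ.*-zeroˡ 0ℚ) (*-mono-≤ ℚ.≤-refl (ℚ.0≤∣p∣ a) ℚ.≤-refl (ℚ.0≤∣p∣ a)))
    where
    open +-*-Solver
    lem : ∣ a ∣ ≡ a ⊎ ∣ a ∣ ≡ - a → ∣ a ∣ * ∣ a ∣ ≡ a * a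
    lem (inj₁ e) = cong₂ _*_ e e
    lem (inj₂ e) = trans (cong₂ _*_ e e)
      (solve 1 (λ a → :- a :* :- a := a :* a) refl a)

  ∣square∣ : ∀ a → ∣ a ∣ * ∣ a ∣ ≡ a * a
  ∣square∣ a = trans (sym (ℚ.∣p*q∣≡∣p∣*∣q∣ a a)) (ℚ.0≤p⇒∣p∣≡p (square-≥0 a))

  ≤∣sum-of-squares∣ : ∀ δ a b → 0ℚ ≤ δ → δ ≤ ∣ a ∣ → δ * δ ≤ ∣ a * a + b * b ∣
  ≤∣sum-of-squares∣ δ a b 0≤δ δ≤ = begin
    δ * δ             ≤⟨ *-mono-≤ {δ} {∣ a ∣} {δ} {∣ a ∣} 0≤δ δ≤ 0≤δ δ≤ ⟩
    ∣ a ∣ * ∣ a ∣     ≡⟨ ∣square∣ a ⟩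
    a * a             ≡⟨ sym (ℚ.+-identityʳ (a * a)) ⟩
    a * a + 0ℚ        ≤⟨ ℚ.+-monoʳ-≤ (a * a) (square-≥0 b) ⟩
    a * a + b * b     ≡⟨ sym (ℚ.0≤p⇒∣p∣≡p (nonneg (square-≥0 a) (square-≥0 b))) ⟩
    ∣ a * a + b * b ∣ ∎
    where
    open ℚ.≤-Reasoning
    nonneg : ∀ {p q} → 0ℚ ≤ p → 0ℚ ≤ q → 0ℚ ≤ p + q
    nonneg = ℚ.+-mono-≤

  ≤∣+∣-cancel : ∀ ε a b → ε ≤ ∣ a + b ∣ → ∣ a ∣ ≤ half ε → half ε ≤ ∣ b ∣
  ≤∣+∣-cancel ε a b p q = ≤-cancelʳ {a = half ε} {b = half ε} {s = ∣ b ∣} (begin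
    half ε + half ε ≡⟨ half+half ε ⟩
    ε               ≤⟨ p ⟩
    ∣ a + b ∣       ≤⟨ ∣+∣≤ {a = a} {b = b} q ℚ.≤-refl ⟩
    half ε + ∣ b ∣  ≡⟨ ℚ.+-comm (half ε) ∣ b ∣ ⟩
    ∣ b ∣ + half ε  ∎)
    where open ℚ.≤-Reasoning

  add-sub : ∀ a b → a + (b - a) ≡ b
  add-sub = solve 2 (λ a b → a :+ (b :- a) := b) refl
    where open +-*-Solver

  cancel-sub : ∀ a b → (a - b) + b ≡ a
  cancel-sub = solve 2 (λ a b → (a :- b) :+ b := a) refl
    where open +-*-Solver

  split-sub : ∀ a b c → a - b ≡ (a - c) + (c - b)
  split-sub = solve 3 (λ a b c → a :- b := (a :- c) :+ (c :- b)) refl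
    where open +-*-Solver

  half≤ : 0ℚ < a → half a ≤ a
  half≤ {a} 0<a = subst₂ _≤_ (ℚ.+-identityʳ (half a)) (half+half a)
    (ℚ.+-monoʳ-≤ (half a) (ℚ.<⇒≤ (half-pos 0<a)))

  half< : 0ℚ < a → half a < a
  half< {a} 0<a = subst₂ _<_ (ℚ.+-identityʳ (half a)) (half+half a)
    (ℚ.+-monoʳ-< (half a) (half-pos 0<a))

module Real where

  open RationalEstimates

  Eventually : (ℕ → Set) → Set
  Eventually P = ∃ λ N → ∀ n → N ℕ.≤ n → P n

  map² : ∀ {P Q R : ℕ → Set} → (∀ {n} → P n → Q n → R n) →
         Eventually P → Eventually Q → Eventually R
  map² f (M , p) (N , q) = M ℕ.⊔ N , λ n le →
    f (p n (ℕ.≤-trans (ℕ.m≤m⊔n M N) le)) (q n (ℕ.≤-trans (ℕ.m≤n⊔m M N) le))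

  map¹ : ∀ {P Q : ℕ → Set} → (∀ {n} → P n → Q n) → Eventually P → Eventually Q
  map¹ f (M , p) = M , λ n le → f (p n le)

  IsCauchy : (ℕ → ℚ) → Set
  IsCauchy s = ∀ ε → 0ℚ ℚ.< ε →
    ∃ λ N → ∀ m n → N ℕ.≤ m → N ℕ.≤ n → ∣ s m ℚ.- s n ∣ ℚ.≤ ε

  IsNull : (ℕ → ℚ) → Set
  IsNull s = ∀ ε → 0ℚ ℚ.< ε → Eventually (λ n → ∣ s n ∣ ℚ.≤ ε)

  IsAwayFrom0 : (ℕ → ℚ) → Set
  IsAwayFrom0 s = ∃ λ δ → 0ℚ ℚ.< δ × Eventually (λ n → δ ℚ.≤ ∣ s n ∣)

  -- The reals are this type up to _≈_ below: Cauchy sequences of rationals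
  -- whose difference is a null sequence are identified.
  record ℝ : Set where
    constructor mkℝ
    field
      seq    : ℕ → ℚ
      cauchy : IsCauchy seq

  open ℝ public

  infix 4 _≈_ _#_

  _≈_ : ℝ → ℝ → Set
  x ≈ y = IsNull (λ n → seq x n ℚ.- seq y n)

  _#_ : ℝ → ℝ → Set
  x # y = IsAwayFrom0 (λ n → seq x n ℚ.- seq y n)

  IsBounded : (ℕ → ℚ) → Set
  IsBounded s = ∃ λ B → 0ℚ ℚ.< B × Eventually (λ n → ∣ s n ∣ ℚ.≤ B)

  bounded : ∀ x → IsBounded (seq x)
  bounded x =
    let N , p = cauchy x 1ℚ (ℚ.positive⁻¹ 1ℚ)
    in ∣ seq x N ∣ ℚ.+ 1ℚ , +-pos {a = ∣ seq x N ∣} (ℚ.0≤∣p∣ (seq x N)) (ℚ.positive⁻¹ 1ℚ) , N , λ n le →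
      subst (λ q → ∣ q ∣ ℚ.≤ ∣ seq x N ∣ ℚ.+ 1ℚ) (add-sub (seq x N) (seq x n))
        (∣+∣≤ {a = seq x N} {b = seq x n ℚ.- seq x N} ℚ.≤-refl (p n N le ℕ.≤-refl))

  IsNull-resp : ∀ {s t : ℕ → ℚ} → (∀ n → s n ≡ t n) → IsNull s → IsNull t
  IsNull-resp e p ε 0<ε = map¹ (λ {n} → subst (λ q → ∣ q ∣ ℚ.≤ ε) (e n)) (p ε 0<ε)

  null-0 : ∀ {s : ℕ → ℚ} → Eventually (λ n → s n ≡ 0ℚ) → IsNull s
  null-0 ev ε 0<ε = map¹ (λ e → subst (λ q → ∣ q ∣ ℚ.≤ ε) (sym e) (ℚ.<⇒≤ 0<ε)) ev

  null-+ : ∀ {s t : ℕ → ℚ} → IsNull s → IsNull t → IsNull (λ n → s n ℚ.+ t n)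
  null-+ p q ε 0<ε = map²
    (λ a b → ℚ.≤-trans (∣+∣≤ a b) (ℚ.≤-reflexive (half+half ε)))
    (p (half ε) (half-pos 0<ε)) (q (half ε) (half-pos 0<ε))

  null-neg : ∀ {s : ℕ → ℚ} → IsNull s → IsNull (λ n → ℚ.- s n)
  null-neg {s} p ε 0<ε =
    map¹ (λ {n} → subst (ℚ._≤ ε) (sym (ℚ.∣-p∣≡∣p∣ (s n)))) (p ε 0<ε)

  null-* : ∀ {s t : ℕ → ℚ} → IsBounded s → IsNull t → IsNull (λ n → s n ℚ.* t n)
  null-* {s} {t} (B , 0<B , b) p ε 0<ε = map²
    (λ {n} a b → ℚ.≤-trans (∣*∣≤ {a = s n} {b = t n} a b)
      (ℚ.≤-trans (ℚ.≤-reflexive (scale-half 0<B ε)) (half≤ 0<ε)))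
    b (p (recip B ℚ.* half ε) (*-pos (recip-pos 0<B) (half-pos 0<ε)))

  pointwise : ∀ {x y} → (∀ n → seq x n ≡ seq y n) → x ≈ y
  pointwise {x} {y} e = null-0 (0 , λ n _ →
    trans (cong (ℚ._- seq y n) (e n)) (ℚ.+-inverseʳ (seq y n)))

  infix  8 -_
  infixl 7 _*_
  infixl 6 _+_ _-_

  fromℚ : ℚ → ℝ
  fromℚ q = mkℝ (λ _ → q) λ ε 0<ε → 0 , λ _ _ _ _ →
    subst (λ p → ∣ p ∣ ℚ.≤ ε) (sym (ℚ.+-inverseʳ q)) (ℚ.<⇒≤ 0<ε)

  0# 1# : ℝ
  0# = fromℚ 0ℚ
  1# = fromℚ 1ℚ

  _+_ : ℝ → ℝ → ℝ
  x + y = mkℝ (λ n → seq x n ℚ.+ seq y n) isCauchy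
    where
    open +-*-Solver
    lem : ∀ a b c d → (a ℚ.- b) ℚ.+ (c ℚ.- d) ≡ (a ℚ.+ c) ℚ.- (b ℚ.+ d)
    lem = solve 4 (λ a b c d → (a :- b) :+ (c :- d) := (a :+ c) :- (b :+ d)) refl
    isCauchy : IsCauchy (λ n → seq x n ℚ.+ seq y n)
    isCauchy ε 0<ε with cauchy x (half ε) (half-pos 0<ε) | cauchy y (half ε) (half-pos 0<ε)
    ... | M , p | N , q = M ℕ.⊔ N , λ m n m≥ n≥ → subst₂ ℚ._≤_
      (cong ∣_∣ (lem (seq x m) (seq x n) (seq y m) (seq y n))) (half+half ε)
      (∣+∣≤ (p m n (ℕ.m⊔n≤o⇒m≤o M N m≥) (ℕ.m⊔n≤o⇒m≤o M N n≥))
            (q m n (ℕ.m⊔n≤o⇒n≤o M N m≥) (ℕ.m⊔n≤o⇒n≤o M N n≥)))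

  -_ : ℝ → ℝ
  - x = mkℝ (λ n → ℚ.- seq x n) isCauchy
    where
    open +-*-Solver
    lem : ∀ a b → b ℚ.- a ≡ ℚ.- a ℚ.- ℚ.- b
    lem = solve 2 (λ a b → b :- a := :- a :- :- b) refl
    isCauchy : IsCauchy (λ n → ℚ.- seq x n)
    isCauchy ε 0<ε with cauchy x ε 0<ε
    ... | N , p = N , λ m n m≥ n≥ →
      subst (λ q → ∣ q ∣ ℚ.≤ ε) (lem (seq x m) (seq x n)) (p n m n≥ m≥)

  _-_ : ℝ → ℝ → ℝ
  x - y = x + - y

  _*_ : ℝ → ℝ → ℝ
  x * y = mkℝ (λ n → seq x n ℚ.* seq y n) isCauchy
    where
    open +-*-Solver
    lem : ∀ a b c d → a ℚ.* (c ℚ.- d) ℚ.+ d ℚ.* (a ℚ.- b) ≡ a ℚ.* c ℚ.- b ℚ.* d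
    lem = solve 4 (λ a b c d → a :* (c :- d) :+ d :* (a :- b) := a :* c :- b :* d) refl
    isCauchy : IsCauchy (λ n → seq x n ℚ.* seq y n)
    isCauchy ε 0<ε =
      let A , 0<A , K , a = bounded x
          B , 0<B , L , b = bounded y
          M , p = cauchy x (recip B ℚ.* half ε) (*-pos (recip-pos 0<B) (half-pos 0<ε))
          N , q = cauchy y (recip A ℚ.* half ε) (*-pos (recip-pos 0<A) (half-pos 0<ε))
      in (K ℕ.⊔ L) ℕ.⊔ (M ℕ.⊔ N) , λ m n m≥ n≥ →
        let KL≤m = ℕ.m⊔n≤o⇒m≤o (K ℕ.⊔ L) (M ℕ.⊔ N) m≥
            KL≤n = ℕ.m⊔n≤o⇒m≤o (K ℕ.⊔ L) (M ℕ.⊔ N) n≥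
            MN≤m = ℕ.m⊔n≤o⇒n≤o (K ℕ.⊔ L) (M ℕ.⊔ N) m≥
            MN≤n = ℕ.m⊔n≤o⇒n≤o (K ℕ.⊔ L) (M ℕ.⊔ N) n≥
        in subst₂ ℚ._≤_
          (cong ∣_∣ (lem (seq x m) (seq x n) (seq y m) (seq y n)))
          (trans (cong₂ ℚ._+_ (scale-half 0<A ε) (scale-half 0<B ε)) (half+half ε))
          (∣+∣≤ {a = seq x m ℚ.* (seq y m ℚ.- seq y n)} {b = seq y n ℚ.* (seq x m ℚ.- seq x n)}
            (∣*∣≤ {a = seq x m} {b = seq y m ℚ.- seq y n}
              (a m (ℕ.m⊔n≤o⇒m≤o K L KL≤m))
              (q m n (ℕ.m⊔n≤o⇒n≤o M N MN≤m) (ℕ.m⊔n≤o⇒n≤o M N MN≤n)))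
            (∣*∣≤ {a = seq y n} {b = seq x m ℚ.- seq x n}
              (b n (ℕ.m⊔n≤o⇒n≤o K L KL≤n))
              (p m n (ℕ.m⊔n≤o⇒m≤o M N MN≤m) (ℕ.m⊔n≤o⇒m≤o M N MN≤n))))

  commutativeRing : CommutativeRing 0ℓ 0ℓ
  commutativeRing = record
    { Carrier = ℝ ; _≈_ = _≈_ ; _+_ = _+_ ; _*_ = _*_ ; -_ = -_ ; 0# = 0# ; 1# = 1#
    ; isCommutativeRing = record
      { isRing = record
        { +-isAbelianGroup = record
          { isGroup = record
            { isMonoid = record
              { isSemigroup = record
                { isMagma = record
                  { isEquivalence = record
                    { refl = λ {x} → pointwise {x} {x} (λ _ → refl)
                    ; sym = λ {x} {y} p → IsNull-resp
                        (λ n → solve 2 (λ a b → :- (a :- b) := b :- a) refl (seq x n) (seq y n))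
                        (null-neg p)
                    ; trans = λ {x} {y} {z} p q → IsNull-resp
                        (λ n → solve 3 (λ a b c → (a :- b) :+ (b :- c) := a :- c) refl
                                 (seq x n) (seq y n) (seq z n))
                        (null-+ p q)
                    }
                  ; ∙-cong = λ {x} {y} {z} {w} p q → IsNull-resp
                      (λ n → solve 4 (λ a b c d → (a :- b) :+ (c :- d) := (a :+ c) :- (b :+ d)) refl
                               (seq x n) (seq y n) (seq z n) (seq w n))
                      (null-+ p q)
                  }
                ; assoc = λ x y z → pointwise {(x + y) + z} {x + (y + z)}
                    λ n → ℚ.+-assoc (seq x n) (seq y n) (seq z n)
                }
              ; identity = (λ x → pointwise {0# + x} {x} λ n → ℚ.+-identityˡ (seq x n))
                         , (λ x → pointwise {x + 0#} {x} λ n → ℚ.+-identityʳ (seq x n))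
              }
            ; inverse = (λ x → pointwise { - x + x} {0#} λ n → ℚ.+-inverseˡ (seq x n))
                      , (λ x → pointwise {x + - x} {0#} λ n → ℚ.+-inverseʳ (seq x n))
            ; ⁻¹-cong = λ {x} {y} p → IsNull-resp
                (λ n → solve 2 (λ a b → :- (a :- b) := :- a :- :- b) refl (seq x n) (seq y n))
                (null-neg p)
            }
          ; comm = λ x y → pointwise {x + y} {y + x} λ n → ℚ.+-comm (seq x n) (seq y n)
          }
        ; *-cong = λ {x} {y} {z} {w} p q → IsNull-resp
            (λ n → solve 4 (λ a b c d → a :* (c :- d) :+ d :* (a :- b) := a :* c :- b :* d) refl
                     (seq x n) (seq y n) (seq z n) (seq w n))
            (null-+ (null-* (bounded x) q) (null-* (bounded w) p))
        ; *-assoc = λ x y z → pointwise {(x * y) * z} {x * (y * z)}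
            λ n → ℚ.*-assoc (seq x n) (seq y n) (seq z n)
        ; *-identity = (λ x → pointwise {1# * x} {x} λ n → ℚ.*-identityˡ (seq x n))
                     , (λ x → pointwise {x * 1#} {x} λ n → ℚ.*-identityʳ (seq x n))
        ; distrib = (λ x y z → pointwise {x * (y + z)} {x * y + x * z}
                        λ n → ℚ.*-distribˡ-+ (seq x n) (seq y n) (seq z n))
                  , (λ x y z → pointwise {(y + z) * x} {y * x + z * x}
                        λ n → ℚ.*-distribʳ-+ (seq x n) (seq y n) (seq z n))
        }
      ; *-comm = λ x y → pointwise {x * y} {y * x} λ n → ℚ.*-comm (seq x n) (seq y n)
      }
    }
    where open +-*-Solver

  away-+ : ∀ (s t : ℕ → ℚ) ε → 0ℚ ℚ.< ε →
           Eventually (λ n → ε ℚ.≤ ∣ s n ℚ.+ t n ∣) →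
           Eventually (λ n → ∣ s n ∣ ℚ.≤ half ε) → IsAwayFrom0 t
  away-+ s t ε 0<ε p q =
    half ε , half-pos 0<ε , map² (λ {n} → ≤∣+∣-cancel ε (s n) (t n)) p q

  away-resp : ∀ (s t : ℕ → ℚ) → IsNull (λ n → s n ℚ.- t n) → IsAwayFrom0 s → IsAwayFrom0 t
  away-resp s t p (δ , 0<δ , ev) = away-+ (λ n → s n ℚ.- t n) t δ 0<δ
    (map¹ (λ {n} → subst (λ q → δ ℚ.≤ ∣ q ∣) (sym (cancel-sub (s n) (t n)))) ev)
    (p (half δ) (half-pos 0<δ))

  dichotomy : ∀ x ε → 0ℚ ℚ.< ε →
              Eventually (λ n → ∣ seq x n ∣ ℚ.≤ ε) ⊎ IsAwayFrom0 (seq x)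
  dichotomy x ε 0<ε = by-size (∣ seq x N ∣ ℚ.≤? half ε)
    where
    modulus = cauchy x (half (half ε)) (half-pos (half-pos 0<ε))
    N = proj₁ modulus
    p = proj₂ modulus
    by-size : Dec (∣ seq x N ∣ ℚ.≤ half ε) →
              Eventually (λ n → ∣ seq x n ∣ ℚ.≤ ε) ⊎ IsAwayFrom0 (seq x)
    by-size (yes small) = inj₁ (N , λ n le → subst₂ (λ q r → ∣ q ∣ ℚ.≤ r)
      (add-sub (seq x N) (seq x n)) (half+half ε)
      (∣+∣≤ {a = seq x N} {b = seq x n ℚ.- seq x N} small
        (ℚ.≤-trans (p n N le ℕ.≤-refl) (half≤ (half-pos 0<ε)))))
    by-size (no large) = inj₂ (away-+ (λ n → seq x N ℚ.- seq x n) (seq x) (half ε) (half-pos 0<ε)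
      (N , λ n le → subst (λ q → half ε ℚ.≤ ∣ q ∣)
        (sym (cancel-sub (seq x N) (seq x n))) (ℚ.<⇒≤ (ℚ.≰⇒> large)))
      (N , λ n le → p N n ℕ.≤-refl le))

  away-split : ∀ x (t : ℕ → ℚ) → IsAwayFrom0 (λ n → seq x n ℚ.+ t n) →
               IsAwayFrom0 (seq x) ⊎ IsAwayFrom0 t
  away-split x t (δ , 0<δ , ev) = Sum.swap (Sum.map₁
    (away-+ (seq x) t δ 0<δ ev) (dichotomy x (half δ) (half-pos 0<δ)))

  away-neg : ∀ (s : ℕ → ℚ) → IsAwayFrom0 (λ n → ℚ.- s n) → IsAwayFrom0 s
  away-neg s (δ , 0<δ , ev) =
    δ , 0<δ , map¹ (λ {n} → subst (δ ℚ.≤_) (ℚ.∣-p∣≡∣p∣ (s n))) ev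

  away-*ʳ : ∀ x (t : ℕ → ℚ) → IsAwayFrom0 (λ n → seq x n ℚ.* t n) → IsAwayFrom0 t
  away-*ʳ x t (δ , 0<δ , ev) =
    let B , 0<B , b = bounded x
    in recip B ℚ.* δ , *-pos (recip-pos 0<B) 0<δ , map² (λ {n} → lem 0<B {n}) ev b
    where
    lem : ∀ {B} → 0ℚ ℚ.< B → ∀ {n} →
          δ ℚ.≤ ∣ seq x n ℚ.* t n ∣ → ∣ seq x n ∣ ℚ.≤ B → recip B ℚ.* δ ℚ.≤ ∣ t n ∣
    lem {B} 0<B {n} p q = ℚ.*-cancelˡ-≤-pos B {{ℚ.positive 0<B}}
      (ℚ.≤-trans (ℚ.≤-reflexive (recip-cancel 0<B δ))
        (ℚ.≤-trans p (∣*∣≤ {a = seq x n} {b = t n} q ℚ.≤-refl)))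

  away-sum-of-squares : ∀ (s t : ℕ → ℚ) → IsAwayFrom0 s →
                        IsAwayFrom0 (λ n → s n ℚ.* s n ℚ.+ t n ℚ.* t n)
  away-sum-of-squares s t (δ , 0<δ , ev) = δ ℚ.* δ , *-pos {δ} {δ} 0<δ 0<δ ,
    map¹ (λ {n} → ≤∣sum-of-squares∣ δ (s n) (t n) (ℚ.<⇒≤ 0<δ)) ev

  away-1 : IsAwayFrom0 (λ _ → 1ℚ)
  away-1 = 1ℚ , ℚ.positive⁻¹ 1ℚ , 0 , λ _ _ → ℚ.≤-refl

  null⇒¬away : ∀ (s : ℕ → ℚ) → IsNull s → ¬ IsAwayFrom0 s
  null⇒¬away s p (δ , 0<δ , N , q) =
    let M , r = p (half δ) (half-pos 0<δ)
    in ℚ.<-irrefl refl (ℚ.<-≤-trans (half< 0<δ) (ℚ.≤-trans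
         (q (M ℕ.⊔ N) (ℕ.m≤n⊔m M N)) (r (M ℕ.⊔ N) (ℕ.m≤m⊔n M N))))

  ¬away⇒null : ∀ x → ¬ IsAwayFrom0 (seq x) → IsNull (seq x)
  ¬away⇒null x ¬away ε 0<ε =
    Sum.[ (λ small → small) , (λ away → ⊥-elim (¬away away)) ] (dichotomy x ε 0<ε)

  inverse : ∀ x → IsAwayFrom0 (seq x) → ∃ λ x⁻¹ → x * x⁻¹ ≈ 1#
  inverse x (δ , 0<δ , N , away) = x⁻¹ , null-0 (N , λ n le →
      trans (cong (ℚ._- 1ℚ) (recip-inverse (seq x n) (∣∣≥⇒≢0 0<δ (away n le)))) (ℚ.+-inverseʳ 1ℚ))
    where
    B : ℚ
    B = recip δ ℚ.* recip δ
    0<B : 0ℚ ℚ.< B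
    0<B = *-pos (recip-pos 0<δ) (recip-pos 0<δ)
    isCauchy : IsCauchy (λ n → recip (seq x n))
    isCauchy ε 0<ε =
      let M , p = cauchy x (recip B ℚ.* ε) (*-pos (recip-pos 0<B) 0<ε)
      in M ℕ.⊔ N , λ m n m≥ n≥ →
        let am = away m (ℕ.m⊔n≤o⇒n≤o M N m≥)
            an = away n (ℕ.m⊔n≤o⇒n≤o M N n≥)
        in subst₂ ℚ._≤_
          (cong ∣_∣ (sym (recip-diff (∣∣≥⇒≢0 0<δ am) (∣∣≥⇒≢0 0<δ an))))
          (recip-cancel 0<B ε)
          (∣*∣≤ {a = recip (seq x m) ℚ.* recip (seq x n)} {b = seq x n ℚ.- seq x m}
            (∣*∣≤ {a = recip (seq x m)} {b = recip (seq x n)} (∣recip∣≤ 0<δ am) (∣recip∣≤ 0<δ an))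
            (p n m (ℕ.m⊔n≤o⇒m≤o M N n≥) (ℕ.m⊔n≤o⇒m≤o M N m≥)))
    x⁻¹ : ℝ
    x⁻¹ = mkℝ (λ n → recip (seq x n)) isCauchy

module Complex where

  open Real
    using (ℝ; seq; IsAwayFrom0; pointwise; away-resp; away-split; away-neg; away-*ʳ;
           away-sum-of-squares; away-1; null⇒¬away; ¬away⇒null)
  private
    module R = CommutativeRing Real.commutativeRing

  infix 8 _+i_
  record ℂ : Set where
    constructor _+i_
    field
      re im : ℝ

  open ℂ public

  infix  8 -_
  infixl 7 _*_
  infixl 6 _+_
  infix  4 _≈_

  _≈_ : ℂ → ℂ → Set
  z ≈ w = re z Real.≈ re w × im z Real.≈ im w

  0# 1# : ℂ
  0# = Real.0# +i Real.0#
  1# = Real.1# +i Real.0#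

  _+_ _*_ : ℂ → ℂ → ℂ
  z + w = (re z Real.+ re w) +i (im z Real.+ im w)
  z * w = (re z Real.* re w Real.- im z Real.* im w) +i (re z Real.* im w Real.+ im z Real.* re w)

  -_ : ℂ → ℂ
  - z = (Real.- re z) +i (Real.- im z)

  private
    pointwise² : ∀ z w →
                 (∀ n → seq (re z) n ≡ seq (re w) n) → (∀ n → seq (im z) n ≡ seq (im w) n) → z ≈ w
    pointwise² z w p q = pointwise {re z} {re w} p , pointwise {im z} {im w} q

  commutativeRing : CommutativeRing 0ℓ 0ℓ
  commutativeRing = record
    { Carrier = ℂ ; _≈_ = _≈_ ; _+_ = _+_ ; _*_ = _*_ ; -_ = -_ ; 0# = 0# ; 1# = 1#
    ; isCommutativeRing = record
      { isRing = record
        { +-isAbelianGroup = record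
          { isGroup = record
            { isMonoid = record
              { isSemigroup = record
                { isMagma = record
                  { isEquivalence = record
                    { refl = λ {z} → pointwise² z z (λ _ → refl) (λ _ → refl)
                    ; sym = λ {z} {w} (p , q) → R.sym {re z} {re w} p , R.sym {im z} {im w} q
                    ; trans = λ {z} {w} {t} (p , q) (p′ , q′) →
                        R.trans {re z} {re w} {re t} p p′ , R.trans {im z} {im w} {im t} q q′
                    }
                  ; ∙-cong = λ {z} {w} {s} {t} (p , q) (p′ , q′) →
                        R.+-cong {re z} {re w} {re s} {re t} p p′
                      , R.+-cong {im z} {im w} {im s} {im t} q q′
                  }
                ; assoc = λ z w t → R.+-assoc (re z) (re w) (re t) , R.+-assoc (im z) (im w) (im t)
                }
              ; identity = (λ z → R.+-identityˡ (re z) , R.+-identityˡ (im z))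
                         , (λ z → R.+-identityʳ (re z) , R.+-identityʳ (im z))
              }
            ; inverse = (λ z → R.-‿inverseˡ (re z) , R.-‿inverseˡ (im z))
                      , (λ z → R.-‿inverseʳ (re z) , R.-‿inverseʳ (im z))
            ; ⁻¹-cong = λ {z} {w} (p , q) →
                R.-‿cong {re z} {re w} p , R.-‿cong {im z} {im w} q
            }
          ; comm = λ z w → R.+-comm (re z) (re w) , R.+-comm (im z) (im w)
          }
        ; *-cong = λ {z} {w} {s} {t} (p , q) (p′ , q′) →
              R.+-cong {re z Real.* re s} {re w Real.* re t}
                       {Real.- (im z Real.* im s)} {Real.- (im w Real.* im t)}
                (R.*-cong {re z} {re w} {re s} {re t} p p′)
                (R.-‿cong {im z Real.* im s} {im w Real.* im t}
                  (R.*-cong {im z} {im w} {im s} {im t} q q′))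
            , R.+-cong {re z Real.* im s} {re w Real.* im t}
                       {im z Real.* re s} {im w Real.* re t}
                (R.*-cong {re z} {re w} {im s} {im t} p q′)
                (R.*-cong {im z} {im w} {re s} {re t} q p′)
        ; *-assoc = λ z w t → pointwise² ((z * w) * t) (z * (w * t))
            (λ n → assoc-re (seq (re z) n) (seq (im z) n) (seq (re w) n) (seq (im w) n) (seq (re t) n) (seq (im t) n))
            (λ n → assoc-im (seq (re z) n) (seq (im z) n) (seq (re w) n) (seq (im w) n) (seq (re t) n) (seq (im t) n))
        ; *-identity = (λ z → pointwise² (1# * z) z
                          (λ n → idˡ-re (seq (re z) n) (seq (im z) n))
                          (λ n → idˡ-im (seq (re z) n) (seq (im z) n)))
                     , (λ z → pointwise² (z * 1#) z
                          (λ n → idʳ-re (seq (re z) n) (seq (im z) n))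
                          (λ n → idʳ-im (seq (re z) n) (seq (im z) n)))
        ; distrib = (λ z w t → pointwise² (z * (w + t)) (z * w + z * t)
            (λ n → distˡ-re (seq (re z) n) (seq (im z) n) (seq (re w) n) (seq (im w) n) (seq (re t) n) (seq (im t) n))
            (λ n → distˡ-im (seq (re z) n) (seq (im z) n) (seq (re w) n) (seq (im w) n) (seq (re t) n) (seq (im t) n)))
                  , (λ z w t → pointwise² ((w + t) * z) (w * z + t * z)
            (λ n → distʳ-re (seq (re z) n) (seq (im z) n) (seq (re w) n) (seq (im w) n) (seq (re t) n) (seq (im t) n))
            (λ n → distʳ-im (seq (re z) n) (seq (im z) n) (seq (re w) n) (seq (im w) n) (seq (re t) n) (seq (im t) n)))
        }
      ; *-comm = λ z w → pointwise² (z * w) (w * z)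
          (λ n → comm-re (seq (re z) n) (seq (im z) n) (seq (re w) n) (seq (im w) n))
          (λ n → comm-im (seq (re z) n) (seq (im z) n) (seq (re w) n) (seq (im w) n))
      }
    }
    where
    open +-*-Solver

    assoc-re : ∀ a b c d e f → (a ℚ.* c ℚ.- b ℚ.* d) ℚ.* e ℚ.- (a ℚ.* d ℚ.+ b ℚ.* c) ℚ.* f ≡ a ℚ.* (c ℚ.* e ℚ.- d ℚ.* f) ℚ.- b ℚ.* (c ℚ.* f ℚ.+ d ℚ.* e)
    assoc-re = solve 6 (λ a b c d e f → (a :* c :- b :* d) :* e :- (a :* d :+ b :* c) :* f := a :* (c :* e :- d :* f) :- b :* (c :* f :+ d :* e)) refl
    assoc-im : ∀ a b c d e f → (a ℚ.* c ℚ.- b ℚ.* d) ℚ.* f ℚ.+ (a ℚ.* d ℚ.+ b ℚ.* c) ℚ.* e ≡ a ℚ.* (c ℚ.* f ℚ.+ d ℚ.* e) ℚ.+ b ℚ.* (c ℚ.* e ℚ.- d ℚ.* f)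
    assoc-im = solve 6 (λ a b c d e f → (a :* c :- b :* d) :* f :+ (a :* d :+ b :* c) :* e := a :* (c :* f :+ d :* e) :+ b :* (c :* e :- d :* f)) refl
    distˡ-re : ∀ a b c d e f → a ℚ.* (c ℚ.+ e) ℚ.- b ℚ.* (d ℚ.+ f) ≡ (a ℚ.* c ℚ.- b ℚ.* d) ℚ.+ (a ℚ.* e ℚ.- b ℚ.* f)
    distˡ-re = solve 6 (λ a b c d e f → a :* (c :+ e) :- b :* (d :+ f) := (a :* c :- b :* d) :+ (a :* e :- b :* f)) refl
    distˡ-im : ∀ a b c d e f → a ℚ.* (d ℚ.+ f) ℚ.+ b ℚ.* (c ℚ.+ e) ≡ (a ℚ.* d ℚ.+ b ℚ.* c) ℚ.+ (a ℚ.* f ℚ.+ b ℚ.* e)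
    distˡ-im = solve 6 (λ a b c d e f → a :* (d :+ f) :+ b :* (c :+ e) := (a :* d :+ b :* c) :+ (a :* f :+ b :* e)) refl
    distʳ-re : ∀ a b c d e f → (c ℚ.+ e) ℚ.* a ℚ.- (d ℚ.+ f) ℚ.* b ≡ (c ℚ.* a ℚ.- d ℚ.* b) ℚ.+ (e ℚ.* a ℚ.- f ℚ.* b)
    distʳ-re = solve 6 (λ a b c d e f → (c :+ e) :* a :- (d :+ f) :* b := (c :* a :- d :* b) :+ (e :* a :- f :* b)) refl
    distʳ-im : ∀ a b c d e f → (c ℚ.+ e) ℚ.* b ℚ.+ (d ℚ.+ f) ℚ.* a ≡ (c ℚ.* b ℚ.+ d ℚ.* a) ℚ.+ (e ℚ.* b ℚ.+ f ℚ.* a)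
    distʳ-im = solve 6 (λ a b c d e f → (c :+ e) :* b :+ (d :+ f) :* a := (c :* b :+ d :* a) :+ (e :* b :+ f :* a)) refl
    comm-re : ∀ a b c d → a ℚ.* c ℚ.- b ℚ.* d ≡ c ℚ.* a ℚ.- d ℚ.* b
    comm-re = solve 4 (λ a b c d → a :* c :- b :* d := c :* a :- d :* b) refl
    comm-im : ∀ a b c d → a ℚ.* d ℚ.+ b ℚ.* c ≡ c ℚ.* b ℚ.+ d ℚ.* a
    comm-im = solve 4 (λ a b c d → a :* d :+ b :* c := c :* b :+ d :* a) refl
    idˡ-re : ∀ a b → 1ℚ ℚ.* a ℚ.- 0ℚ ℚ.* b ≡ a
    idˡ-re = solve 2 (λ a b → con 1ℚ :* a :- con 0ℚ :* b := a) refl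
    idˡ-im : ∀ a b → 1ℚ ℚ.* b ℚ.+ 0ℚ ℚ.* a ≡ b
    idˡ-im = solve 2 (λ a b → con 1ℚ :* b :+ con 0ℚ :* a := b) refl
    idʳ-re : ∀ a b → a ℚ.* 1ℚ ℚ.- b ℚ.* 0ℚ ≡ a
    idʳ-re = solve 2 (λ a b → a :* con 1ℚ :- b :* con 0ℚ := a) refl
    idʳ-im : ∀ a b → a ℚ.* 0ℚ ℚ.+ b ℚ.* 1ℚ ≡ b
    idʳ-im = solve 2 (λ a b → a :* con 0ℚ :+ b :* con 1ℚ := b) refl

  private
    module C = CommutativeRing commutativeRing

    conjugate-inverse : ∀ z n → (re z Real.* re z Real.+ im z Real.* im z) Real.* n Real.≈ Real.1# →
                        ((re z Real.* n) +i (Real.- (im z Real.* n))) * z ≈ 1#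
    conjugate-inverse z n p =
        R.trans {re (z̄n * z)} {(re z Real.* re z Real.+ im z Real.* im z) Real.* n} {Real.1#}
          (pointwise {re (z̄n * z)} {(re z Real.* re z Real.+ im z Real.* im z) Real.* n}
            λ k → lem-re (seq (re z) k) (seq (im z) k) (seq n k)) p
      , pointwise {im (z̄n * z)} {Real.0#} (λ k → lem-im (seq (re z) k) (seq (im z) k) (seq n k))
      where
      open +-*-Solver
      z̄n = (re z Real.* n) +i (Real.- (im z Real.* n))
      lem-re : ∀ a b n → (a ℚ.* n) ℚ.* a ℚ.- (ℚ.- (b ℚ.* n)) ℚ.* b ≡ (a ℚ.* a ℚ.+ b ℚ.* b) ℚ.* n
      lem-re = solve 3 (λ a b n → (a :* n) :* a :- (:- (b :* n)) :* b := (a :* a :+ b :* b) :* n) refl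
      lem-im : ∀ a b n → (a ℚ.* n) ℚ.* b ℚ.+ (ℚ.- (b ℚ.* n)) ℚ.* a ≡ 0ℚ
      lem-im = solve 3 (λ a b n → (a :* n) :* b :+ (:- (b :* n)) :* a := con 0ℚ) refl

  infix 4 _#_

  _#_ : ℂ → ℂ → Set
  z # w = re z Real.# re w ⊎ im z Real.# im w

  private
    #-sym-ℝ : ∀ {x y} → x Real.# y → y Real.# x
    #-sym-ℝ {x} {y} (δ , 0<δ , N , p) =
      δ , 0<δ , N , λ n le → subst (δ ℚ.≤_) (RationalEstimates.∣-∣-swap (seq x n) (seq y n)) (p n le)

    #-cotrans-ℝ : ∀ {x y} → x Real.# y → ∀ z → x Real.# z ⊎ z Real.# y
    #-cotrans-ℝ {x} {y} (δ , 0<δ , N , p) z =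
      away-split (x Real.- z) (seq (z Real.- y))
        (δ , 0<δ , N , λ n le → subst (λ q → δ ℚ.≤ ∣ q ∣)
          (RationalEstimates.split-sub (seq x n) (seq y n) (seq z n)) (p n le))

    ∣_∣² : ℂ → ℝ
    ∣ z ∣² = re z Real.* re z Real.+ im z Real.* im z

    ∣∣²-away : ∀ z → IsAwayFrom0 (seq (re z)) ⊎ IsAwayFrom0 (seq (im z)) → IsAwayFrom0 (seq ∣ z ∣²)
    ∣∣²-away z (inj₁ p) = away-sum-of-squares (seq (re z)) (seq (im z)) p
    ∣∣²-away z (inj₂ p) = away-resp (seq (y² Real.+ x²)) (seq (x² Real.+ y²))
      (R.+-comm y² x²) (away-sum-of-squares (seq (im z)) (seq (re z)) p)
      where
      x² = re z Real.* re z
      y² = im z Real.* im z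

    open import Algebra.Definitions C._≈_ using (Invertible)

    #⇒invertible : ∀ {z w} → z # w → Invertible 1# _*_ (z C.- w)
    #⇒invertible {z} {w} p = d⁻¹ , d⁻¹*d≈1 , C.trans {d * d⁻¹} {d⁻¹ * d} {1#} (C.*-comm d d⁻¹) d⁻¹*d≈1
      where
      d = z C.- w
      ∣d∣⁻² = Real.inverse ∣ d ∣² (∣∣²-away d p)
      d⁻¹ = (re d Real.* proj₁ ∣d∣⁻²) +i (Real.- (im d Real.* proj₁ ∣d∣⁻²))
      d⁻¹*d≈1 = conjugate-inverse d (proj₁ ∣d∣⁻²) (proj₂ ∣d∣⁻²)

    invertible⇒# : ∀ {z w} → Invertible 1# _*_ (z C.- w) → z # w
    invertible⇒# {z} {w} (u , (p , _) , _) = Sum.map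
      (away-*ʳ (re u) (seq (re d)))
      (λ a → away-*ʳ (im u) (seq (im d)) (away-neg (seq (im u Real.* im d)) a))
      (away-split (re u Real.* re d) (seq (Real.- (im u Real.* im d)))
        (away-resp (seq Real.1#) (seq (re (u * d))) (R.sym {re (u * d)} {Real.1#} p) away-1))
      where d = z C.- w

  heytingField : HeytingField 0ℓ 0ℓ 0ℓ
  heytingField = record
    { Carrier = ℂ ; _≈_ = _≈_ ; _#_ = _#_ ; _+_ = _+_ ; _*_ = _*_ ; -_ = -_ ; 0# = 0# ; 1# = 1#
    ; isHeytingField = record
      { isHeytingCommutativeRing = record
        { isCommutativeRing = C.isCommutativeRing
        ; isApartnessRelation = record
          { irrefl = λ {z} {w} → irrefl {z} {w}
          ; sym = λ {z} {w} → Sum.map (#-sym-ℝ {re z} {re w}) (#-sym-ℝ {im z} {im w})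
          ; cotrans = λ {z} {w} p t → cotrans z w t p
          }
        ; #⇒invertible = λ {z} {w} → #⇒invertible {z} {w}
        ; invertible⇒# = λ {z} {w} → invertible⇒# {z} {w}
        }
      ; tight = λ z w →
          (λ ¬p → ¬away⇒null (re z Real.- re w) (λ a → ¬p (inj₁ a))
                , ¬away⇒null (im z Real.- im w) (λ a → ¬p (inj₂ a)))
        , irrefl {z} {w}
      }
    }
    where
    cotrans : ∀ z w t → z # w → z # t ⊎ t # w
    cotrans z w t (inj₁ p) = Sum.map inj₁ inj₁ (#-cotrans-ℝ {re z} {re w} p (re t))
    cotrans z w t (inj₂ p) = Sum.map inj₂ inj₂ (#-cotrans-ℝ {im z} {im w} p (im t))
    irrefl : ∀ {z w} → z ≈ w → ¬ (z # w)
    irrefl {z} {w} (p , _) (inj₁ a) = null⇒¬away (seq (re z Real.- re w)) p a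
    irrefl {z} {w} (_ , q) (inj₂ a) = null⇒¬away (seq (im z Real.- im w)) q a

-- "Nonzero" is rendered as apartness from zero, which is what division
-- requires constructively.
module LucasSequences {c ℓ₁ ℓ₂} (K : HeytingField c ℓ₁ ℓ₂) where

  open HeytingField K
  open CommutativeRing
    (HeytingCommutativeRing.commutativeRing (HeytingField.heytingCommutativeRing K))
    using (semiring; +-commutativeMonoid)
  open import Algebra.Apartness.Properties.HeytingCommutativeRing
    (HeytingField.heytingCommutativeRing K) using (x-0≈x)
  open import Algebra.Properties.Semiring.Exp semiring public using (_^_)
  open import Algebra.Properties.CommutativeMonoid.Sum +-commutativeMonoid using (sum)

  infix 9 _⁻¹⟨_⟩ _^ℤ⟨_,_⟩

  _⁻¹⟨_⟩ : ∀ x → x # 0# → Carrier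
  x ⁻¹⟨ x#0 ⟩ = proj₁ (#⇒invertible x#0)

  *-inverseʳ : ∀ x (x#0 : x # 0#) → x * x ⁻¹⟨ x#0 ⟩ ≈ 1#
  *-inverseʳ x x#0 =
    HeytingField.trans K (*-congʳ (HeytingField.sym K (x-0≈x x)))
      (proj₂ (proj₂ (#⇒invertible x#0)))

  -- The base has to be nonzero only when the exponent is negative; 0⁰ = 1.
  _^ℤ⟨_,_⟩ : ∀ x k → (k ℤ.< 0ℤ → x # 0#) → Carrier
  x ^ℤ⟨ + m      , _   ⟩ = x ^ m
  x ^ℤ⟨ -[1+ m ] , x#0 ⟩ = (x ⁻¹⟨ x#0 ℤ.-<+ ⟩) ^ suc m

  _⁺ : ℤ → ℕ
  (+ m)    ⁺ = m
  -[1+ _ ] ⁺ = 0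

  -- The sum over all integers k with a ≤ k ≤ b, empty if b < a.  The summand
  -- receives a proof of a ≤ k, which x ^ k needs when x may be zero.
  ∑[_,_] : ∀ a b → (∀ k → a ℤ.≤ k → Carrier) → Carrier
  ∑[ a , b ] f =
    sum {(b ℤ.- a ℤ.+ 1ℤ) ⁺} λ i → f (a ℤ.+ + toℕ i) (ℤ.i≤i+j a (+ toℕ i))

  2# 4# : Carrier
  2# = 1# + 1#
  4# = 2# + 2#

  recurrence : (w₀ w₁ y z : Carrier) → ℕ → Carrier
  recurrence w₀ w₁ y z zero          = w₀
  recurrence w₀ w₁ y z (suc zero)    = w₁
  recurrence w₀ w₁ y z (suc (suc n)) =
    y * recurrence w₀ w₁ y z (suc n) - z * recurrence w₀ w₁ y z n

  -- u₋ₙ = - uₙ / zⁿ and v₋ₙ = vₙ / zⁿ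
  lucasU lucasV : (y z : Carrier) → z # 0# → ℤ → Carrier
  lucasU y z z#0 (+ n)    = recurrence 0# 1# y z n
  lucasU y z z#0 -[1+ n ] =
    - (recurrence 0# 1# y z (suc n) * z ^ℤ⟨ -[1+ n ] , (λ _ → z#0) ⟩)
  lucasV y z z#0 (+ n)    = recurrence 2# y y z n
  lucasV y z z#0 -[1+ n ] =
    recurrence 2# y y z (suc n) * z ^ℤ⟨ -[1+ n ] , (λ _ → z#0) ⟩

-- Opaque, so that type checking never unfolds complex arithmetic into
-- operations on Cauchy sequences.
opaque
  ℂ-heytingField : HeytingField 0ℓ 0ℓ 0ℓ
  ℂ-heytingField = Complex.heytingField

open HeytingField ℂ-heytingField public
  using (_≈_; _#_; _+_; _*_; _-_; -_; 0#; 1#) renaming (Carrier to ℂ)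
open LucasSequences ℂ-heytingField public

{-# OPTIONS --safe #-}
-- Both Lucas sequences satisfy a companion relation e(k) + r y w(k) = 2 r w(k+1) on all
-- of ℤ, with e = r v for w = u and e = (y² - 4z) r u for w = v.  It turns the k-th
-- summand into G(k+1) - G(k), where G(k) = r^(n+1-k) x^k y w(k), and the sum telescopes.
module Submission where

open import Defs
open import Algebra.Apartness.Bundles using (HeytingCommutativeRing; HeytingField)
open import Algebra.Bundles using (CommutativeRing)
open import Data.Fin.Base using (Fin; zero; suc; toℕ)
open import Data.Fin.Properties using (toℕ≤pred[n])
open import Data.Integer.Base as ℤ using (ℤ; 0ℤ; 1ℤ; ∣_∣; +_; -[1+_])
import Data.Integer.Properties as ℤ
open import Data.Integer.Properties using (≤-<-trans; ≤-refl; ≤-trans; i≤i+j)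
import Data.Integer.Solver as ℤ
open import Data.Nat.Base as ℕ using (ℕ; zero; suc; _∸_)
import Data.Nat.Properties as ℕ
open import Data.Product.Base using (_×_; _,_)
open import Relation.Binary.PropositionalEquality as ≡ using (_≡_)

private
  commutativeRing : CommutativeRing _ _
  commutativeRing = HeytingCommutativeRing.commutativeRing
    (HeytingField.heytingCommutativeRing ℂ-heytingField)

open CommutativeRing commutativeRing
  using ( refl; sym; trans; reflexive; setoid; ring; +-group; +-commutativeMonoid
        ; commutativeSemiring; distribˡ; zeroˡ; zeroʳ; -‿inverseˡ; -‿inverseʳ; -‿cong
        ; +-cong; +-congˡ; +-congʳ; +-identityˡ
        ; *-cong; *-congˡ; *-congʳ; *-identityˡ; *-identityʳ; *-assoc )
open import Algebra.Properties.CommutativeMonoid.Sum +-commutativeMonoid using (sum)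
open import Algebra.Properties.Group +-group using (x≈z//y; ∙-cancelʳ)
open import Algebra.Properties.Ring ring using (-‿distribˡ-*; -‿distribʳ-*)
open import Algebra.Solver.Ring.NaturalCoefficients.Default commutativeSemiring
  using (solve; con; _:=_; _:+_; _:*_)
open import Relation.Binary.Reasoning.Setoid setoid
open ℤ.+-*-Solver using ()
  renaming (solve to solveℤ; con to conℤ; _:=_ to _=ℤ_; _:+_ to _+ℤ_; _:-_ to _-ℤ_)

-- Telescoping sums and integer powers.

sum-telescope : ∀ {N} (f : Fin N → ℂ) (g : ℕ → ℂ) →
  (∀ i → f i + g (toℕ i) ≈ g (suc (toℕ i))) → sum f + g 0 ≈ g N
sum-telescope {zero}  f g step = +-identityˡ (g 0)
sum-telescope {suc N} f g step = begin
  f zero + S + g 0   ≈⟨ solve 3 (λ a s b → a :+ s :+ b := s :+ (a :+ b)) refl (f zero) S (g 0) ⟩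
  S + (f zero + g 0) ≈⟨ +-congˡ (step zero) ⟩
  S + g 1            ≈⟨ sum-telescope (λ i → f (suc i)) (λ i → g (suc i)) (λ i → step (suc i)) ⟩
  g (suc N)          ∎
  where S = sum (λ i → f (suc i))

-- The chosen inverse depends on the proof of apartness, and powers of x at different indices carry
-- different proofs; this makes them comparable.
⁻¹-unique : ∀ {x} (p q : x # 0#) → x ⁻¹⟨ p ⟩ ≈ x ⁻¹⟨ q ⟩
⁻¹-unique {x} p q = begin
  x ⁻¹⟨ p ⟩                   ≈⟨ *-identityʳ _ ⟨
  x ⁻¹⟨ p ⟩ * 1#              ≈⟨ *-congˡ (*-inverseʳ x q) ⟨
  x ⁻¹⟨ p ⟩ * (x * x ⁻¹⟨ q ⟩) ≈⟨ solve 3 (λ a b c → b :* (a :* c) := a :* b :* c) refl x (x ⁻¹⟨ p ⟩) (x ⁻¹⟨ q ⟩) ⟩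
  x * x ⁻¹⟨ p ⟩ * x ⁻¹⟨ q ⟩   ≈⟨ *-congʳ (*-inverseʳ x p) ⟩
  1# * x ⁻¹⟨ q ⟩              ≈⟨ *-identityˡ _ ⟩
  x ⁻¹⟨ q ⟩                   ∎

^-congˡ : ∀ {a b} m → a ≈ b → a ^ m ≈ b ^ m
^-congˡ zero    a≈b = refl
^-congˡ (suc m) a≈b = *-cong a≈b (^-congˡ m a≈b)

^ℤ-cong : ∀ {x k l} {p : k ℤ.< 0ℤ → x # 0#} {q : l ℤ.< 0ℤ → x # 0#} →
  k ≡ l → x ^ℤ⟨ k , p ⟩ ≈ x ^ℤ⟨ l , q ⟩
^ℤ-cong {k = + m}      ≡.refl = refl
^ℤ-cong {k = -[1+ m ]} {p = p} {q} ≡.refl = ^-congˡ (suc m) (⁻¹-unique (p ℤ.-<+) (q ℤ.-<+))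

^-⁻¹-suc : ∀ {x} (p : x # 0#) m → (x ⁻¹⟨ p ⟩) ^ m ≈ x * (x ⁻¹⟨ p ⟩) ^ suc m
^-⁻¹-suc {x} p m = begin
  (x ⁻¹⟨ p ⟩) ^ m                 ≈⟨ *-identityˡ _ ⟨
  1# * (x ⁻¹⟨ p ⟩) ^ m            ≈⟨ *-congʳ (*-inverseʳ x p) ⟨
  x * x ⁻¹⟨ p ⟩ * (x ⁻¹⟨ p ⟩) ^ m ≈⟨ *-assoc _ _ _ ⟩
  x * (x ⁻¹⟨ p ⟩) ^ suc m         ∎

^ℤ-suc : ∀ {x} k {p : k ℤ.+ 1ℤ ℤ.< 0ℤ → x # 0#} {q : k ℤ.< 0ℤ → x # 0#} →
  x ^ℤ⟨ k ℤ.+ 1ℤ , p ⟩ ≈ x * x ^ℤ⟨ k , q ⟩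
^ℤ-suc {x} (+ m)          = reflexive (≡.cong (x ^_) (ℕ.+-comm m 1))
-- The exponent passes from -1 to 0: `x ^ 0` and the zeroth power of the inverse both compute to
-- `1#`.
^ℤ-suc     -[1+ zero  ] {q = q} = ^-⁻¹-suc (q ℤ.-<+) 0
^ℤ-suc     -[1+ suc m ] {p} {q} =
  trans (^-congˡ (suc m) (⁻¹-unique (p ℤ.-<+) (q ℤ.-<+))) (^-⁻¹-suc (q ℤ.-<+) (suc m))

-- Companion relations of the Lucas sequences.

module _ (y z : ℂ) where

  -- Subtraction becomes addition with `- z` as an atom, because the ring solver works over a
  -- commutative semiring.
  recurrence-step : ∀ w₀ w₁ n → let W = recurrence w₀ w₁ y z in
    W (suc (suc n)) ≈ y * W (suc n) + - z * W n
  recurrence-step w₀ w₁ n = +-congˡ (-‿distribˡ-* z _)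

  module _ {d a₀ a₁ w₀ w₁ : ℂ}
    (base₀ : d * a₀ + y * w₀ ≈ 2# * w₁)
    (base₁ : d * a₁ + y * w₁ ≈ 2# * (y * w₁ - z * w₀))
    where

    private
      A W : ℕ → ℂ
      A = recurrence a₀ a₁ y z
      W = recurrence w₀ w₁ y z

    -- Both sides are linear in sequences with the same second-order recurrence, so agreement at 0
    -- and 1 suffices.
    recurrence-companion : ∀ n → d * A n + y * W n ≈ 2# * W (suc n)
    recurrence-companion zero          = base₀
    recurrence-companion (suc zero)    = base₁
    recurrence-companion (suc (suc n)) = begin
      d * A (2 ℕ.+ n) + y * W (2 ℕ.+ n)
        ≈⟨ +-cong (*-congˡ (recurrence-step a₀ a₁ n)) (*-congˡ (recurrence-step w₀ w₁ n)) ⟩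
      d * (y * A (suc n) + - z * A n) + y * (y * W (suc n) + - z * W n)
        ≈⟨ solve 7 (λ d y q a b s t → d :* (y :* b :+ q :* a) :+ y :* (y :* t :+ q :* s)
             := y :* (d :* b :+ y :* t) :+ q :* (d :* a :+ y :* s))
             refl d y (- z) (A n) (A (suc n)) (W n) (W (suc n)) ⟩
      y * (d * A (suc n) + y * W (suc n)) + - z * (d * A n + y * W n)
        ≈⟨ +-cong (*-congˡ (recurrence-companion (suc n))) (*-congˡ (recurrence-companion n)) ⟩
      y * (2# * W (2 ℕ.+ n)) + - z * (2# * W (suc n))
        ≈⟨ solve 5 (λ y q t s k → y :* (k :* t) :+ q :* (k :* s) := k :* (y :* t :+ q :* s))
             refl y (- z) (W (2 ℕ.+ n)) (W (suc n)) 2# ⟩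
      2# * (y * W (2 ℕ.+ n) + - z * W (suc n))
        ≈⟨ *-congˡ (recurrence-step w₀ w₁ (suc n)) ⟨
      2# * W (3 ℕ.+ n) ∎

    -- The relation at n + 1 with W(n+2) eliminated by the recurrence. It looks back to W(n), as is
    -- needed at index -(n+1), whose successor is -n.
    recurrence-companion⁻ : ∀ n → d * A (suc n) + 2# * z * W n ≈ y * W (suc n)
    recurrence-companion⁻ n = ∙-cancelʳ (y * W (suc n)) _ _ (begin
      d * A (suc n) + 2# * z * W n + y * W (suc n)
        ≈⟨ solve 3 (λ a b c → a :+ b :+ c := a :+ c :+ b) refl _ _ _ ⟩
      d * A (suc n) + y * W (suc n) + 2# * z * W n
        ≈⟨ +-congʳ (recurrence-companion (suc n)) ⟩
      2# * W (2 ℕ.+ n) + 2# * z * W n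
        ≈⟨ +-congʳ (*-congˡ (recurrence-step w₀ w₁ n)) ⟩
      2# * (y * W (suc n) + - z * W n) + 2# * z * W n
        ≈⟨ solve 5 (λ y q z s t → con 2 :* (y :* t :+ q :* s) :+ con 2 :* z :* s
             := con 2 :* s :* (q :+ z) :+ (y :* t :+ y :* t))
             refl y (- z) z (W n) (W (suc n)) ⟩
      2# * W n * (- z + z) + (y * W (suc n) + y * W (suc n))
        ≈⟨ +-congʳ (trans (*-congˡ (-‿inverseˡ z)) (zeroʳ _)) ⟩
      0# + (y * W (suc n) + y * W (suc n))
        ≈⟨ +-identityˡ _ ⟩
      y * W (suc n) + y * W (suc n) ∎)

    -- The relation at index -(n+1), where one of the two sequences is extended to
    -- negative indices by the factor s = z⁻⁽ⁿ⁺¹⁾ or - z⁻⁽ⁿ⁺¹⁾ and the other by - s.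
    companion-negative : ∀ n {s t t′} → s + t ≈ 0# → t′ ≈ z * t →
      d * (A (suc n) * s) + y * (W (suc n) * t) ≈ 2# * (W n * t′)
    companion-negative n {s} {t} {t′} s+t≈0 t′≈zt = begin
      d * (A (suc n) * s) + y * (W (suc n) * t)
        ≈⟨ +-congˡ (*-assoc _ _ _) ⟨
      d * (A (suc n) * s) + y * W (suc n) * t
        ≈⟨ +-congˡ (*-congʳ (recurrence-companion⁻ n)) ⟨
      d * (A (suc n) * s) + (d * A (suc n) + 2# * z * W n) * t
        ≈⟨ solve 7 (λ d a z w s t k → d :* (a :* s) :+ (d :* a :+ k :* z :* w) :* t
             := d :* a :* (s :+ t) :+ k :* (w :* (z :* t)))
             refl d (A (suc n)) z (W n) s t 2# ⟩
      d * A (suc n) * (s + t) + 2# * (W n * (z * t))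
        ≈⟨ +-cong (trans (*-congˡ s+t≈0) (zeroʳ _)) (*-congˡ (*-congˡ (sym t′≈zt))) ⟩
      0# + 2# * (W n * t′)
        ≈⟨ +-identityˡ _ ⟩
      2# * (W n * t′) ∎

  module _ (z≠0 : z # 0#) where

    private
      u v : ℤ → ℂ
      u = lucasU y z z≠0
      v = lucasV y z z≠0
      U V : ℕ → ℂ
      U = recurrence 0# 1# y z
      V = recurrence 2# y y z
      z⁻ : ℕ → ℂ
      z⁻ n = (z ⁻¹⟨ z≠0 ⟩) ^ n

    -- The index is -n, which for n = 0 falls under the nonnegative clause of `lucasU`; the product
    -- form covers both cases at once.
    lucasU-neg : ∀ n → u (-[1+ n ] ℤ.+ 1ℤ) ≈ U n * - z⁻ n
    lucasU-neg zero    = sym (zeroˡ _)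
    lucasU-neg (suc n) = -‿distribʳ-* _ _

    lucasV-neg : ∀ n → v (-[1+ n ] ℤ.+ 1ℤ) ≈ V n * z⁻ n
    lucasV-neg zero    = sym (*-identityʳ _)
    lucasV-neg (suc n) = refl

    private
      -- The discriminant of the characteristic polynomial t² - y t + z.
      y²-4z : ℂ
      y²-4z = y ^ 2 - 4# * z

      base-u₀ : 1# * 2# + y * 0# ≈ 2# * 1#
      base-u₀ = solve 1 (λ y → con 1 :* con 2 :+ y :* con 0 := con 2 :* con 1) refl y

      base-u₁ : 1# * y + y * 1# ≈ 2# * (y * 1# - z * 0#)
      base-u₁ = begin
        1# * y + y * 1#            ≈⟨ solve 2 (λ y q → con 1 :* y :+ y :* con 1
                                        := con 2 :* (y :* con 1 :+ q :* con 0)) refl y (- z) ⟩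
        2# * (y * 1# + - z * 0#)   ≈⟨ *-congˡ (+-congˡ (-‿distribˡ-* z 0#)) ⟨
        2# * (y * 1# - z * 0#)     ∎

      base-v₀ : y²-4z * 0# + y * 2# ≈ 2# * y
      base-v₀ = solve 2 (λ d y → d :* con 0 :+ y :* con 2 := con 2 :* y) refl y²-4z y

      base-v₁ : y²-4z * 1# + y * y ≈ 2# * (y * y - z * 2#)
      base-v₁ = begin
        (y ^ 2 - 4# * z) * 1# + y * y ≈⟨ +-congʳ (*-congʳ (+-congˡ (-‿distribʳ-* 4# z))) ⟩
        (y ^ 2 + 4# * - z) * 1# + y * y
          ≈⟨ solve 2 (λ y q → (y :* (y :* con 1) :+ (con 2 :+ con 2) :* q) :* con 1 :+ y :* y
               := con 2 :* (y :* y :+ q :* con 2)) refl y (- z) ⟩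
        2# * (y * y + - z * 2#)       ≈⟨ *-congˡ (+-congˡ (-‿distribˡ-* z 2#)) ⟨
        2# * (y * y - z * 2#)         ∎

    -- The factor `1#` is the coefficient d of the general relation, here with A = V and W = U; the
    -- second kind has the roles exchanged and d = y² - 4z.
    lucas-companion-u : ∀ k → 1# * v k + y * u k ≈ 2# * u (k ℤ.+ 1ℤ)
    lucas-companion-u (+ n) = trans (recurrence-companion base-u₀ base-u₁ n)
      (reflexive (≡.cong (λ m → 2# * U m) (ℕ.+-comm 1 n)))
    lucas-companion-u -[1+ n ] = begin
      1# * (V (suc n) * z⁻ (suc n)) + y * - (U (suc n) * z⁻ (suc n))
        ≈⟨ +-congˡ (*-congˡ (-‿distribʳ-* _ _)) ⟩
      1# * (V (suc n) * z⁻ (suc n)) + y * (U (suc n) * - z⁻ (suc n))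
        ≈⟨ companion-negative base-u₀ base-u₁ n (-‿inverseʳ _)
             (trans (-‿cong (^-⁻¹-suc z≠0 n)) (-‿distribʳ-* _ _)) ⟩
      2# * (U n * - z⁻ n)
        ≈⟨ *-congˡ (lucasU-neg n) ⟨
      2# * u (-[1+ n ] ℤ.+ 1ℤ) ∎

    lucas-companion-v : ∀ k → (y ^ 2 - 4# * z) * u k + y * v k ≈ 2# * v (k ℤ.+ 1ℤ)
    lucas-companion-v (+ n) = trans (recurrence-companion base-v₀ base-v₁ n)
      (reflexive (≡.cong (λ m → 2# * V m) (ℕ.+-comm 1 n)))
    lucas-companion-v -[1+ n ] = begin
      y²-4z * - (U (suc n) * z⁻ (suc n)) + y * (V (suc n) * z⁻ (suc n))
        ≈⟨ +-congʳ (*-congˡ (-‿distribʳ-* _ _)) ⟩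
      y²-4z * (U (suc n) * - z⁻ (suc n)) + y * (V (suc n) * z⁻ (suc n))
        ≈⟨ companion-negative base-v₀ base-v₁ n (-‿inverseˡ _) (^-⁻¹-suc z≠0 n) ⟩
      2# * (V n * z⁻ n)
        ≈⟨ *-congˡ (lucasV-neg n) ⟨
      2# * v (-[1+ n ] ℤ.+ 1ℤ) ∎

-- Telescoping over an integer interval.

n≡c+∣n-c∣ : ∀ {c n} → c ℤ.≤ n → n ≡ c ℤ.+ + ∣ n ℤ.- c ∣
n≡c+∣n-c∣ {c} {n} c≤n = ≡.trans
  (solveℤ 2 (λ c n → n =ℤ c +ℤ (n -ℤ c)) ≡.refl c n)
  (≡.cong (λ i → c ℤ.+ i) (≡.sym (ℤ.0≤i⇒+∣i∣≡i (ℤ.i≤j⇒0≤j-i c≤n))))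

[c+m]-[c+i]≡m⊖i : ∀ c m i → (c ℤ.+ + m) ℤ.- (c ℤ.+ + i) ≡ m ℤ.⊖ i
[c+m]-[c+i]≡m⊖i c m i = ≡.trans
  (solveℤ 3 (λ c m i → (c +ℤ m) -ℤ (c +ℤ i) =ℤ m -ℤ i) ≡.refl c (+ m) (+ i))
  (ℤ.m-n≡m⊖n m i)

[c+m]-c+1≡1+m : ∀ c m → (c ℤ.+ + m) ℤ.- c ℤ.+ 1ℤ ≡ + suc m
[c+m]-c+1≡1+m c m =
  solveℤ 2 (λ c m → (c +ℤ m) -ℤ c +ℤ conℤ 1ℤ =ℤ conℤ 1ℤ +ℤ m) ≡.refl c (+ m)

-- Read R as r^(n-k) and X as x^k. The added term completes e to e + r y w, which the hypothesis
-- cancels against - 2 r w′, leaving only x y w′.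
telescoping-summand : ∀ r R X x y {e w w′} → e + r * (y * w) ≈ 2# * r * w′ →
  R * X * (e + (x * y - 2# * r) * w′) + r * R * X * y * w ≈ R * (x * X) * y * w′
telescoping-summand r R X x y {e} {w} {w′} companion = begin
  R * X * (e + (x * y - 2# * r) * w′) + r * R * X * y * w
    ≈⟨ solve 9 (λ r R X x y e w w′ t →
         R :* X :* (e :+ (x :* y :+ t) :* w′) :+ r :* R :* X :* y :* w
         := R :* X :* ((e :+ r :* (y :* w)) :+ t :* w′) :+ R :* (x :* X) :* y :* w′)
         refl r R X x y e w w′ (- (2# * r)) ⟩
  R * X * ((e + r * (y * w)) + - (2# * r) * w′) + R * (x * X) * y * w′
    ≈⟨ +-congʳ (*-congˡ (trans (+-cong companion (sym (-‿distribˡ-* _ _))) (-‿inverseʳ _))) ⟩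
  R * X * 0# + R * (x * X) * y * w′
    ≈⟨ +-congʳ (zeroʳ _) ⟩
  0# + R * (x * X) * y * w′
    ≈⟨ +-identityˡ _ ⟩
  R * (x * X) * y * w′ ∎

module _ (y x r : ℂ) (c : ℤ) (x≠0 : c ℤ.< 0ℤ → x # 0#) where

  private
    x^ : ∀ k → c ℤ.≤ k → ℂ
    x^ = λ k c≤k → x ^ℤ⟨ k , (λ k<0 → x≠0 (≤-<-trans c≤k k<0)) ⟩

  companion-sum : ∀ (e w : ℤ → ℂ) → (∀ k → e k + r * (y * w k) ≈ 2# * r * w (k ℤ.+ 1ℤ)) →
    ∀ n (c≤n : c ℤ.≤ n) (c≤n+1 : c ℤ.≤ n ℤ.+ 1ℤ) →
    (∑[ c , n ] λ k c≤k →
       r ^ ∣ n ℤ.- k ∣ * x^ k c≤k * (e k + (x * y - 2# * r) * w (k ℤ.+ 1ℤ)))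
      ≈ x^ (n ℤ.+ 1ℤ) c≤n+1 * y * w (n ℤ.+ 1ℤ)
          - r ^ ∣ n ℤ.- c ℤ.+ 1ℤ ∣ * x^ c ≤-refl * y * w c
  companion-sum e w companion n c≤n c≤n+1 = go n ∣ n ℤ.- c ∣ (n≡c+∣n-c∣ c≤n) c≤n+1
    where
    summand : ∀ n k → c ℤ.≤ k → ℂ
    summand n k c≤k = r ^ ∣ n ℤ.- k ∣ * x^ k c≤k * (e k + (x * y - 2# * r) * w (k ℤ.+ 1ℤ))

    -- G(k) for n = c + m and k = c + i; the truncated subtraction is exact as long as i ≤ m + 1.
    g : ℕ → ℕ → ℂ
    g m i = r ^ (suc m ∸ i) * x^ (c ℤ.+ + i) (i≤i+j c (+ i)) * y * w (c ℤ.+ + i)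

    -- Rewriting an index also changes the inequality proof inside the power of x; `^ℤ-cong` absorbs
    -- the difference.
    g-cong : ∀ {R R′ k l} {c≤k : c ℤ.≤ k} {c≤l : c ℤ.≤ l} → R ≡ R′ → k ≡ l →
      R * x^ k c≤k * y * w k ≈ R′ * x^ l c≤l * y * w l
    g-cong {R} {k = k} ≡.refl ≡.refl = *-congʳ (*-congʳ (*-congˡ {R} (^ℤ-cong {k = k} ≡.refl)))

    step : ∀ m i → i ℕ.≤ m →
      summand (c ℤ.+ + m) (c ℤ.+ + i) (i≤i+j c (+ i)) + g m i ≈ g m (suc i)
    -- The rewrites turn the exponent n - k into `m ∸ i` and the exponent `suc m ∸ i` in `g m i`
    -- into `suc (m ∸ i)`, which exposes one factor r.
    step m i i≤m
      rewrite [c+m]-[c+i]≡m⊖i c m i | ℤ.⊖-≥ i≤m | ℕ.+-∸-assoc 1 i≤m = begin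
      _ ≈⟨ telescoping-summand r (r ^ (m ∸ i)) _ x y (companion (c ℤ.+ + i)) ⟩
      r ^ (m ∸ i) * (x * x^ (c ℤ.+ + i) (i≤i+j c (+ i))) * y * w (c ℤ.+ + i ℤ.+ 1ℤ)
        ≈⟨ *-congʳ (*-congʳ (*-congˡ (^ℤ-suc (c ℤ.+ + i) {p = λ k<0 → x≠0 (≤-<-trans c≤k+1 k<0)}))) ⟨
      r ^ (m ∸ i) * x^ (c ℤ.+ + i ℤ.+ 1ℤ) c≤k+1 * y * w (c ℤ.+ + i ℤ.+ 1ℤ)
        ≈⟨ g-cong ≡.refl (≡.trans (ℤ.+-assoc c (+ i) 1ℤ) (≡.cong (λ j → c ℤ.+ + j) (ℕ.+-comm i 1))) ⟩
      g m (suc i) ∎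
      where
      c≤k+1 : c ℤ.≤ c ℤ.+ + i ℤ.+ 1ℤ
      c≤k+1 = ≤-trans (i≤i+j c (+ i)) (i≤i+j (c ℤ.+ + i) 1ℤ)

    -- With n a variable, matching on the equation replaces it by c + m everywhere, including in the
    -- inequality proofs.
    go : ∀ n m → n ≡ c ℤ.+ + m → (c≤n+1 : c ℤ.≤ n ℤ.+ 1ℤ) → ∑[ c , n ] (summand n)
      ≈ x^ (n ℤ.+ 1ℤ) c≤n+1 * y * w (n ℤ.+ 1ℤ)
          - r ^ ∣ n ℤ.- c ℤ.+ 1ℤ ∣ * x^ c ≤-refl * y * w c
    -- The rewrite fixes both the number of summands and the exponent of r in the boundary term at c
    -- as m + 1.
    go n m ≡.refl c≤n+1 rewrite [c+m]-c+1≡1+m c m = x≈z//y _ _ _ (begin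
      sum {suc m} (λ i → summand (c ℤ.+ + m) (c ℤ.+ + toℕ i) (i≤i+j c (+ toℕ i)))
        + r ^ suc m * x^ c ≤-refl * y * w c
        ≈⟨ +-congˡ (g-cong ≡.refl (≡.sym (ℤ.+-identityʳ c))) ⟩
      sum {suc m} (λ i → summand (c ℤ.+ + m) (c ℤ.+ + toℕ i) (i≤i+j c (+ toℕ i))) + g m 0
        ≈⟨ sum-telescope {suc m} _ (g m) (λ i → step m (toℕ i) (toℕ≤pred[n] i)) ⟩
      g m (suc m)
        -- At the upper end k = n + 1 the exponent of r is 0.
        ≈⟨ g-cong (≡.cong (r ^_) (ℕ.n∸n≡0 m))
             (≡.sym (≡.trans (ℤ.+-assoc c (+ m) 1ℤ) (≡.cong (λ j → c ℤ.+ + j) (ℕ.+-comm m 1)))) ⟩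
      1# * x^ (c ℤ.+ + m ℤ.+ 1ℤ) c≤n+1 * y * w (c ℤ.+ + m ℤ.+ 1ℤ)
        ≈⟨ *-congʳ (*-congʳ (*-identityˡ _)) ⟩
      x^ (c ℤ.+ + m ℤ.+ 1ℤ) c≤n+1 * y * w (c ℤ.+ + m ℤ.+ 1ℤ) ∎)

theorem1 :
  ∀ (y z : ℂ) (y≠0 : y # 0#) (z≠0 : z # 0#) (x r : ℂ) (c n : ℤ) (c≤n : c ℤ.≤ n) (x≠0 : c ℤ.< 0ℤ → x # 0#) →
  let
    u : ℤ → ℂ
    u = lucasU y z z≠0
    v : ℤ → ℂ
    v = lucasV y z z≠0
    -- the power x ^ k, for c ≤ k
    x^ : ∀ k → c ℤ.≤ k → ℂ
    x^ = λ k c≤k → x ^ℤ⟨ k , (λ k<0 → x≠0 (≤-<-trans c≤k k<0)) ⟩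
    c≤n+1 : c ℤ.≤ n ℤ.+ 1ℤ
    c≤n+1 = ≤-trans c≤n (i≤i+j n 1ℤ)
  in
    -- c ≤ k ≤ n throughout, so ∣ n - k ∣ is the exponent n - k, and likewise for n - c + 1
    (∑[ c , n ] λ k c≤k →
       r ^ ∣ n ℤ.- k ∣ * x^ k c≤k * (r * v k + (x * y - 2# * r) * u (k ℤ.+ 1ℤ)))
      ≈ x^ (n ℤ.+ 1ℤ) c≤n+1 * y * u (n ℤ.+ 1ℤ)
          - r ^ ∣ n ℤ.- c ℤ.+ 1ℤ ∣ * x^ c ≤-refl * y * u c
    ×
    (∑[ c , n ] λ k c≤k →
       r ^ ∣ n ℤ.- k ∣ * x^ k c≤k * ((y ^ 2 - 4# * z) * r * u k + (x * y - 2# * r) * v (k ℤ.+ 1ℤ)))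
      ≈ x^ (n ℤ.+ 1ℤ) c≤n+1 * y * v (n ℤ.+ 1ℤ)
          - r ^ ∣ n ℤ.- c ℤ.+ 1ℤ ∣ * x^ c ≤-refl * y * v c
theorem1 y z y≠0 z≠0 x r c n c≤n x≠0 =
    companion-sum y x r c x≠0 (λ k → r * v k) u companion-u n c≤n c≤n+1
  , companion-sum y x r c x≠0 (λ k → (y ^ 2 - 4# * z) * r * u k) v companion-v n c≤n c≤n+1
  where
  u v : ℤ → ℂ
  u = lucasU y z z≠0
  v = lucasV y z z≠0
  c≤n+1 : c ℤ.≤ n ℤ.+ 1ℤ
  c≤n+1 = ≤-trans c≤n (i≤i+j n 1ℤ)
  -- Multiplying by r brings a companion relation into the form that `companion-sum` expects.
  scale : ∀ {e d a w w′} → e ≈ r * (d * a) → d * a + y * w ≈ 2# * w′ →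
    e + r * (y * w) ≈ 2# * r * w′
  scale {e} {d} {a} {w} {w′} e≈ rel = begin
    e + r * (y * w)           ≈⟨ +-congʳ e≈ ⟩
    r * (d * a) + r * (y * w) ≈⟨ distribˡ r _ _ ⟨
    r * (d * a + y * w)       ≈⟨ *-congˡ rel ⟩
    r * (2# * w′)             ≈⟨ solve 3 (λ r k w → r :* (k :* w) := k :* r :* w) refl r 2# w′ ⟩
    2# * r * w′               ∎
  companion-u : ∀ k → r * v k + r * (y * u k) ≈ 2# * r * u (k ℤ.+ 1ℤ)
  companion-u k = scale (*-congˡ (sym (*-identityˡ _))) (lucas-companion-u y z z≠0 k)
  companion-v : ∀ k → (y ^ 2 - 4# * z) * r * u k + r * (y * v k) ≈ 2# * r * v (k ℤ.+ 1ℤ)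
  companion-v k = scale (solve 3 (λ r d a → d :* r :* a := r :* (d :* a)) refl r _ _)
    (lucas-companion-v y z z≠0 k)
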